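{- Let $n>k>t\ge1$ be integers, let $\mathcal F\subset\binom{[n]}{k}$ be a shifted pseudo $t$-intersecting family of width $w=w_t(\mathcal F)$. Then for every integer $0<j\le t$, $$|\partial_R^j\mathcal F|\ \ge\ |\mathcal F|\,\frac{\binom{t+2w}{t-j+w}}{\binom{t+2w}{t+w}}.$$
   Context: $[n]=\{1,\dots,n\}$, and $\binom{Y}{k}$ is the collection of all $k$-element subsets of $Y$. Shifted: for $k$-sets $A=\{a_1<\dots<a_k\}$, $B=\{b_1<\dots<b_k\}$ write $A\prec B$ iff $a_i\le b_i$ for all $1\le i\le k$; $\mathcal F\subset\binom{[n]}{k}$ is shifted if $A\prec B$ and $B\in\mathcal F$ always imply $A\in\mathcal F$. Pseudo $t$-intersecting: for every $F\in\mathcal F$ there is an integer $h$, $0\le h\le k-t$, with $|F\cap[t+2h]|\ge t+h$. Width $w_t(\mathcal F)$: the minimum integer $w\ge 0$ such that for every $F\in\mathcal F$ there is an $h$ with $0\le h\le w$ and $|F\cap[t+2h]|\ge t+h$. Height of $F\in\mathcal F$: $h(F)=\max\{h: 0\le h\le w_t(\mathcal F),\ |F\cap[t+2h]|\ge t+h\}$. Tail of $F$: $T(F)=F\setminus[t+2h(F)]$. Restricted $j$'th shadow of $F\in\mathcal F$: $\partial_R^jF=\{G\in\binom{F}{k-j}: T(F)\subset G\}$; and $\partial_R^j\mathcal F=\bigcup_{F\in\mathcal F}\partial_R^jF$. -}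

module Defs where

open import Data.Fin using (Fin; toℕ)
import Data.Fin as Fin
open import Data.Fin.Subset
  using (Subset; inside; outside; _∈_; _⊆_; _∩_; _─_; ∣_∣)
open import Data.Fin.Subset.Properties using (_∈?_; _⊆?_; anySubset?)
open import Data.List using (List; []; _∷_; _++_; map; filter; length; upTo; allFin)
open import Data.List.Extrema.Nat using (max)
open import Data.List.Relation.Binary.Pointwise using (Pointwise)
open import Data.Nat
open import Data.Nat.Combinatorics using (_C_; nCk≡n!/k![n-k]!; k![n∸k]!∣n!)
open import Data.Nat.Divisibility using (∣⇒≤)
open import Data.Nat.DivMod using (m≥n⇒m/n>0)
open import Data.Nat.Properties
open import Data.Product using (∃-syntax; _×_)
import Data.Vec as Vec
open import Level using (0ℓ)
open import Relation.Binary.PropositionalEquality using (_≡_; sym; subst)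
open import Relation.Nullary.Decidable using (_×-dec_)
open import Relation.Unary using (Pred; Decidable)

private
  variable
    n : ℕ

-- Subset n encodes the subsets of {1,…,n}: the index i : Fin n stands for
-- the element toℕ i + 1.

Family : ℕ → Set₁
Family n = Pred (Subset n) 0ℓ

subsets : ∀ n → List (Subset n)
subsets zero    = Vec.[] ∷ []
subsets (suc n) = map (outside Vec.∷_) (subsets n) ++ map (inside Vec.∷_) (subsets n)

card : {ℱ : Family n} → Decidable ℱ → ℕ
card ℱ? = length (filter ℱ? (subsets _))

Uniform : ℕ → Family n → Set
Uniform k ℱ = ∀ {F} → ℱ F → ∣ F ∣ ≡ k

-- {1,…,m} ∩ {1,…,n}; m may exceed n.
[1⋯_] : ℕ → Subset n
[1⋯ m ] = Vec.tabulate (λ i → toℕ i <ᵇ m)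

-- In increasing order, because allFin is.
elements : Subset n → List (Fin n)
elements A = filter (_∈? A) (allFin _)

infix 4 _≺_

_≺_ : Subset n → Subset n → Set
A ≺ B = Pointwise Fin._≤_ (elements A) (elements B)

Shifted : ℕ → Family n → Set
Shifted k ℱ = ∀ {A B} → ∣ A ∣ ≡ k → ∣ B ∣ ≡ k → A ≺ B → ℱ B → ℱ A

Heavy : ℕ → Subset n → ℕ → Set
Heavy t F h = t + h ≤ ∣ F ∩ [1⋯ t + 2 * h ] ∣

heavy? : ∀ t (F : Subset n) → Decidable (Heavy t F)
heavy? t F h = t + h ≤? ∣ F ∩ [1⋯ t + 2 * h ] ∣

PseudoIntersecting : ℕ → ℕ → Family n → Set
PseudoIntersecting k t ℱ = ∀ {F} → ℱ F → ∃[ h ] (h ≤ k ∸ t × Heavy t F h)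

WidthBound : ℕ → Family n → ℕ → Set
WidthBound t ℱ w = ∀ {F} → ℱ F → ∃[ h ] (h ≤ w × Heavy t F h)

-- w is the width w_t(ℱ). A relation rather than a function, since the
-- minimum need not exist for an arbitrary family; it does exist when ℱ is
-- pseudo t-intersecting.
IsWidth : ℕ → Family n → ℕ → Set
IsWidth t ℱ w = WidthBound t ℱ w × (∀ {v} → WidthBound t ℱ v → w ≤ v)

-- In height, tail and the shadows, w is the width of the ambient family. The
-- set whose maximum is taken is then nonempty for every member F of that
-- family, so the default 0 of max plays no role.
height : ℕ → ℕ → Subset n → ℕ
height t w F = max 0 (filter (heavy? t F) (upTo (suc w)))

tail : ℕ → ℕ → Subset n → Subset n
tail t w F = F ─ [1⋯ t + 2 * height t w F ]

shadowOf : (k t w j : ℕ) → Subset n → Family n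
shadowOf k t w j F G = ∣ G ∣ ≡ k ∸ j × G ⊆ F × tail t w F ⊆ G

shadow : (k t w j : ℕ) → Family n → Family n
shadow k t w j ℱ G = ∃[ F ] (ℱ F × shadowOf k t w j F G)

shadow? : ∀ k t w j {ℱ : Family n} → Decidable ℱ → Decidable (shadow k t w j ℱ)
shadow? k t w j ℱ? G = anySubset? λ F →
  ℱ? F ×-dec (∣ G ∣ ≟ k ∸ j ×-dec (G ⊆? F ×-dec tail t w F ⊆? G))

C-nonZero : ∀ {m r} → r ≤ m → NonZero (m C r)
C-nonZero {m} {r} r≤m = >-nonZero (subst (0 <_) (sym (nCk≡n!/k![n-k]! r≤m))
  (m≥n⇒m/n>0 (∣⇒≤ {{m !≢0}} (k![n∸k]!∣n! r≤m))))
  where instance _ = r !* (m ∸ r) !≢0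

denominator-nonZero : ∀ t w → NonZero ((t + 2 * w) C (t + w))
denominator-nonZero t w = C-nonZero (+-monoʳ-≤ t (m≤m+n w (w + 0)))

{-# OPTIONS --safe #-}

-- Join F ∈ ℱ to each G ∈ ∂_R^j F.  All the F above a given G have the same
-- height h: were F′ higher than F, then F, which agrees with G beyond t + 2h,
-- would satisfy |F ∩ [t + 2h′]| = |G ∩ [t + 2h′]| + j ≥ |F′ ∩ [t + 2h′]| and be
-- heavy at h′ as well.  Put a = |F ∩ [t + 2h]| ≥ t + h.  Then F has C(a, j)
-- neighbours, while every F above G arises from G by adding j elements of
-- [t + 2h] ∖ G, which has at most h + j elements.  Double counting leaves the
-- binomial inequality
--   C(t + 2w, t − j + w) C(h + j, j) ≤ C(t + 2w, t + w) C(a, j),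
-- which reduces to a = t + h and is an equality there for h = w.

module Submission where

open import Defs
open import Data.Bool using (if_then_else_)
open import Data.Fin.Subset
  using (Subset; inside; outside; _∈_; _∉_; _⊆_; _∩_; _∪_; _─_; ∣_∣)
open import Data.Fin.Subset.Properties
  using ( drop-∷-⊆; out⊆; s⊆s; _∈?_; _⊆?_; p⊆q⇒∣p∣≤∣q∣; ∩-comm; p⊆p∪q; q⊆p∪q
        ; x∈p∧x∉q⇒x∈p─q; p─q⊆p)
open import Data.Integer using (+_; +≤+)
import Data.Integer as ℤ
import Data.Integer.Properties as ℤ
open import Data.List using (List; []; _∷_; _++_; map; filter; length; upTo)
open import Data.List.Extrema.Nat using (argmax-sel; xs≤max)
open import Data.List.Membership.Propositional using (lose) renaming (_∈_ to _∈ˡ_)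
open import Data.List.Membership.Propositional.Properties
  using (∈-filter⁺; ∈-filter⁻; ∈-upTo⁺; ∈-upTo⁻)
open import Data.List.Properties
  using (length-filter; filter-some; filter-none; filter-++; filter-≐; length-++)
open import Data.List.Relation.Unary.All using (lookup; universal)
import Data.List.Relation.Unary.Any as Any
open import Data.Nat renaming (_/_ to _/ℕ_)
open import Data.Nat.Combinatorics
  using (_C_; nCk+nC[k+1]≡[n+1]C[k+1]; nCk≡n!/k![n-k]!; k![n∸k]!∣n!; nCk≡nC[n∸k])
open import Data.Nat.Divisibility using (∣-trans; m∣m*n; m≤n⇒m!∣n!)
open import Data.Nat.DivMod using (m/n*n≡m)
open import Data.Nat.ListAction using (sum)
open import Data.Nat.Properties
open import Data.Nat.Tactic.RingSolver using (solve-∀)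
open import Data.Product using (∃-syntax; _×_; _,_; proj₁; proj₂)
open import Data.Rational.Unnormalised using (_/_; *≤*) renaming (_*_ to _*ℚ_; _≥_ to _≥ℚ_)
open import Data.Sum using (inj₁; inj₂)
open import Data.Vec using ([]; _∷_; here; there)
open import Function using (id; _∘_)
open import Level using (Level)
open import Relation.Binary using (REL) renaming (Decidable to Decidable₂)
open import Relation.Binary.PropositionalEquality
open import Relation.Nullary using (Dec; ¬_; does; yes; no; contradiction)
open import Relation.Nullary.Decidable using (_×-dec_)
open import Relation.Unary using (Pred; Decidable; _≐_) renaming (_⊆_ to _⇒_)

private
  variable
    n : ℕ
    ℓ₁ ℓ₂ ℓ₃ ℓ₄ ℓ₅ : Level
    X : Set ℓ₁
    Y : Set ℓ₂

-- Weighted double counting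

indicator : {P : Set ℓ₁} → Dec P → ℕ
indicator P? = if does P? then 1 else 0

length-filter≡sum : {P : Pred X ℓ₂} (P? : Decidable P) (xs : List X) →
  length (filter P? xs) ≡ sum (map (λ x → indicator (P? x)) xs)
length-filter≡sum P? []       = refl
length-filter≡sum P? (x ∷ xs) with P? x
... | yes _ = cong suc (length-filter≡sum P? xs)
... | no  _ = length-filter≡sum P? xs

sum-map-*ʳ : (f : X → ℕ) (c : ℕ) (xs : List X) →
  sum (map (λ x → f x * c) xs) ≡ sum (map f xs) * c
sum-map-*ʳ f c []       = refl
sum-map-*ʳ f c (x ∷ xs) =
  trans (cong₂ _+_ (refl {x = f x * c}) (sum-map-*ʳ f c xs)) (sym (*-distribʳ-+ c (f x) _))

sum-map-0 : (xs : List X) → sum (map (λ _ → 0) xs) ≡ 0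
sum-map-0 []       = refl
sum-map-0 (_ ∷ xs) = sum-map-0 xs

sum-map-+ : (f g : X → ℕ) (xs : List X) →
  sum (map (λ x → f x + g x) xs) ≡ sum (map f xs) + sum (map g xs)
sum-map-+ f g []       = refl
sum-map-+ f g (x ∷ xs) = trans (cong₂ _+_ (refl {x = f x + g x}) (sum-map-+ f g xs)) (interchange (f x) (g x) _ _)
  where
  interchange : ∀ a b c d → a + b + (c + d) ≡ a + c + (b + d)
  interchange = solve-∀

sum-map-mono : {f g : X → ℕ} (xs : List X) → (∀ {x} → x ∈ˡ xs → f x ≤ g x) →
  sum (map f xs) ≤ sum (map g xs)
sum-map-mono []       f≤g = z≤n
sum-map-mono (x ∷ xs) f≤g = +-mono-≤ (f≤g (Any.here refl)) (sum-map-mono xs (λ x∈ → f≤g (Any.there x∈)))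

sum-map-swap : (f : X → Y → ℕ) (xs : List X) (ys : List Y) →
  sum (map (λ x → sum (map (f x) ys)) xs) ≡ sum (map (λ y → sum (map (λ x → f x y) xs)) ys)
sum-map-swap f []       ys = sym (sum-map-0 ys)
sum-map-swap f (x ∷ xs) ys =
  trans (cong₂ _+_ (refl {x = sum (map (f x) ys)}) (sum-map-swap f xs ys)) (sym (sum-map-+ (f x) _ ys))

-- Meaningful for 0 < d ≤ B only, where d divides B !.
share : ℕ → ℕ → ℕ
share B zero    = 0
share B (suc d) = B ! /ℕ suc d

share-* : ∀ {B d} → 0 < d → d ≤ B → share B d * d ≡ B !
share-* {B} {suc d} _ d≤B = m/n*n≡m (∣-trans (m∣m*n (d !)) (m≤n⇒m!∣n! d≤B))

-- Equality fails at `d = 0`, where the left side is 0. This case does occur: a `y` satisfying `Q`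
-- may have no neighbour.
share-*-≤ : ∀ {B d} → d ≤ B → share B d * d ≤ B !
share-*-≤ {d = zero}  _   = z≤n
share-*-≤ {d = suc d} d≤B = ≤-reflexive (share-* z<s d≤B)

module _ {X : Set ℓ₁} {Y : Set ℓ₂} {R : REL X Y ℓ₃} (R? : Decidable₂ R) (xs : List X) (ys : List Y) where

  degreeˡ : X → ℕ
  degreeˡ x = length (filter (R? x) ys)

  degreeʳ : Y → ℕ
  degreeʳ y = length (filter (λ x → R? x y) xs)

  private
    -- A common bound on all degrees, so that every positive degree divides `B !`.
    B : ℕ
    B = length xs + length ys

    degreeˡ≤B : ∀ x → degreeˡ x ≤ B
    degreeˡ≤B x = ≤-trans (length-filter (R? x) ys) (m≤n+m _ _)

    degreeʳ≤B : ∀ y → degreeʳ y ≤ B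
    degreeʳ≤B y = ≤-trans (length-filter (λ x → R? x y) xs) (m≤m+n _ _)

  -- Each edge x ~ y carries the weight N/deg x ≤ M/deg y; the former sum to
  -- N over the edges at x, the latter to M over the edges at y.  Multiplying
  -- by B ! keeps the weights integral.
  weighted-double-count : {P : Pred X ℓ₄} {Q : Pred Y ℓ₅} (P? : Decidable P) (Q? : Decidable Q) (N M : ℕ) →
    (∀ {x} → P x → 0 < degreeˡ x) →
    (∀ {x y} → R x y → Q y) →
    (∀ {x y} → R x y → N * degreeʳ y ≤ M * degreeˡ x) →
    N * length (filter P? xs) ≤ M * length (filter Q? ys)
  weighted-double-count P? Q? N M P⇒0<deg R⇒Q R⇒≤ = *-cancelˡ-≤ (B !) (begin
    B ! * (N * length (filter P? xs))
      ≡⟨ rearrange (B !) N _ ⟩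
    length (filter P? xs) * (N * B !)
      ≡⟨ cong (_* (N * B !)) (length-filter≡sum P? xs) ⟩
    sum (map (λ x → indicator (P? x)) xs) * (N * B !)
      ≡⟨ sum-map-*ʳ _ (N * B !) xs ⟨
    sum (map (λ x → indicator (P? x) * (N * B !)) xs)
      ≤⟨ sum-map-mono xs (λ {x} _ → row x) ⟩
    sum (map (λ x → sum (map (λ y → indicator (R? x y) * (N * shareˡ x)) ys)) xs)
      ≤⟨ sum-map-mono xs (λ x∈ → sum-map-mono ys (λ y∈ → edge x∈ y∈)) ⟩
    sum (map (λ x → sum (map (λ y → indicator (R? x y) * (M * shareʳ y)) ys)) xs)
      ≡⟨ sum-map-swap _ xs ys ⟩
    sum (map (λ y → sum (map (λ x → indicator (R? x y) * (M * shareʳ y)) xs)) ys)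
      ≤⟨ sum-map-mono ys (λ {y} _ → column y) ⟩
    sum (map (λ y → indicator (Q? y) * (M * B !)) ys)
      ≡⟨ sum-map-*ʳ _ (M * B !) ys ⟩
    sum (map (λ y → indicator (Q? y)) ys) * (M * B !)
      ≡⟨ cong (_* (M * B !)) (length-filter≡sum Q? ys) ⟨
    length (filter Q? ys) * (M * B !)
      ≡⟨ rearrange (B !) M _ ⟨
    B ! * (M * length (filter Q? ys)) ∎)
    where
    open ≤-Reasoning
    instance _ = B !≢0

    rearrange : ∀ a b c → a * (b * c) ≡ c * (b * a)
    rearrange = solve-∀

    exchange : ∀ a b c → a * (b * c) ≡ b * (c * a)
    exchange = solve-∀

    shareˡ : X → ℕ
    shareˡ x = share B (degreeˡ x)

    shareʳ : Y → ℕ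
    shareʳ y = share B (degreeʳ y)

    row : ∀ x → indicator (P? x) * (N * B !) ≤ sum (map (λ y → indicator (R? x y) * (N * shareˡ x)) ys)
    row x with P? x
    ... | no  _  = z≤n
    ... | yes px = ≤-reflexive (begin-equality
      1 * (N * B !)
        ≡⟨ *-identityˡ _ ⟩
      N * B !
        ≡⟨ cong (N *_) (share-* (P⇒0<deg px) (degreeˡ≤B x)) ⟨
      N * (shareˡ x * degreeˡ x)
        ≡⟨ exchange (degreeˡ x) N (shareˡ x) ⟨
      degreeˡ x * (N * shareˡ x)
        ≡⟨ cong (_* (N * shareˡ x)) (length-filter≡sum (R? x) ys) ⟩
      sum (map (λ y → indicator (R? x y)) ys) * (N * shareˡ x)
        ≡⟨ sum-map-*ʳ _ _ ys ⟨
      sum (map (λ y → indicator (R? x y) * (N * shareˡ x)) ys) ∎)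

    column : ∀ y → sum (map (λ x → indicator (R? x y) * (M * shareʳ y)) xs) ≤ indicator (Q? y) * (M * B !)
    column y = begin
      sum (map (λ x → indicator (R? x y) * (M * shareʳ y)) xs)
        ≡⟨ sum-map-*ʳ _ _ xs ⟩
      sum (map (λ x → indicator (R? x y)) xs) * (M * shareʳ y)
        ≡⟨ cong (_* (M * shareʳ y)) (length-filter≡sum (λ x → R? x y) xs) ⟨
      degreeʳ y * (M * shareʳ y)
        ≤⟨ total ⟩
      indicator (Q? y) * (M * B !) ∎
      where
      total : degreeʳ y * (M * shareʳ y) ≤ indicator (Q? y) * (M * B !)
      total with Q? y
      -- Every edge at `y` would give `Q y`, so here `y` has degree 0.
      ... | no ¬qy = ≤-reflexive (cong (λ zs → length zs * (M * shareʳ y))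
              (filter-none (λ x → R? x y) (universal (λ x rxy → ¬qy (R⇒Q rxy)) xs)))
      ... | yes _  = begin
        degreeʳ y * (M * shareʳ y) ≡⟨ exchange (degreeʳ y) M (shareʳ y) ⟩
        M * (shareʳ y * degreeʳ y) ≤⟨ *-monoʳ-≤ M (share-*-≤ (degreeʳ≤B y)) ⟩
        M * B !                    ≡⟨ *-identityˡ _ ⟨
        1 * (M * B !)              ∎

    -- Multiplying by both degrees clears the shares and leaves the hypothesis `R⇒≤`. The degrees
    -- are positive because the edge is itself counted at both ends, which is where membership in
    -- `xs` and `ys` enters.
    edge : ∀ {x y} → x ∈ˡ xs → y ∈ˡ ys →
      indicator (R? x y) * (N * shareˡ x) ≤ indicator (R? x y) * (M * shareʳ y)
    edge {x} {y} x∈ y∈ with R? x y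
    ... | no  _   = z≤n
    ... | yes rxy = *-monoʳ-≤ 1 (*-cancelʳ-≤ _ _ (d * d′) {{m*n≢0 d d′}} (begin
      N * shareˡ x * (d * d′)   ≡⟨ regroup N (shareˡ x) d d′ ⟩
      shareˡ x * d * (N * d′)   ≡⟨ cong (_* (N * d′)) (share-* 0<d (degreeˡ≤B x)) ⟩
      B ! * (N * d′)            ≤⟨ *-monoʳ-≤ (B !) (R⇒≤ rxy) ⟩
      B ! * (M * d)             ≡⟨ cong (_* (M * d)) (share-* 0<d′ (degreeʳ≤B y)) ⟨
      shareʳ y * d′ * (M * d)   ≡⟨ regroup M (shareʳ y) d′ d ⟨
      M * shareʳ y * (d′ * d)   ≡⟨ cong (M * shareʳ y *_) (*-comm d′ d) ⟩
      M * shareʳ y * (d * d′)   ∎))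
      where
      d  = degreeˡ x
      d′ = degreeʳ y

      0<d : 0 < d
      0<d = filter-some (R? x) (lose y∈ rxy)

      0<d′ : 0 < d′
      0<d′ = filter-some (λ x → R? x y) (lose x∈ rxy)

      instance
        _ = >-nonZero 0<d
        _ = >-nonZero 0<d′

      regroup : ∀ a b c d → a * b * (c * d) ≡ b * c * (a * d)
      regroup = solve-∀

-- Binomial coefficients

nCk≤[1+n]Ck : ∀ n k → n C k ≤ suc n C k
nCk≤[1+n]Ck n zero    = ≤-refl
nCk≤[1+n]Ck n (suc k) = ≤-trans (m≤n+m _ _) (≤-reflexive (nCk+nC[k+1]≡[n+1]C[k+1] n k))

C-monoˡ-≤ : ∀ k {m n} → m ≤ n → m C k ≤ n C k
C-monoˡ-≤ k m≤n = go (≤⇒≤′ m≤n)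
  where
  go : ∀ {m n} → m ≤′ n → m C k ≤ n C k
  go ≤′-refl       = ≤-refl
  go (≤′-step m≤n) = ≤-trans (go m≤n) (nCk≤[1+n]Ck _ k)

-- The factorial formula without division or truncated subtraction. The identities below follow from
-- it by multiplying through by factorials and cancelling them.
C-factorial : ∀ a b → ((a + b) C a) * (a ! * b !) ≡ (a + b) !
C-factorial a b = begin
  ((a + b) C a) * (a ! * b !)
    ≡⟨ cong (λ c → ((a + b) C a) * (a ! * c !)) (m+n∸m≡n a b) ⟨
  ((a + b) C a) * (a ! * (a + b ∸ a) !)
    ≡⟨ cong (_* (a ! * (a + b ∸ a) !)) (nCk≡n!/k![n-k]! (m≤m+n a b)) ⟩
  ((a + b) ! /ℕ (a ! * (a + b ∸ a) !)) * (a ! * (a + b ∸ a) !)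
    ≡⟨ m/n*n≡m (k![n∸k]!∣n! (m≤m+n a b)) ⟩
  (a + b) ! ∎
  where
  open ≡-Reasoning
  instance _ = a !* (a + b ∸ a) !≢0

C-symmetric : ∀ a b → ((a + b) C a) ≡ ((a + b) C b)
C-symmetric a b = trans (nCk≡nC[n∸k] (m≤m+n a b)) (cong ((a + b) C_) (m+n∸m≡n a b))

-- Times `j ! * x !`, both sides become `(suc j + x) !`. This peels one linear factor off a binomial
-- coefficient, for induction on `j`.
C-absorption : ∀ j x → suc j * ((suc j + x) C suc j) ≡ (suc j + x) * ((j + x) C j)
C-absorption j x = *-cancelʳ-≡ _ _ (j ! * x !) (begin
  suc j * ((suc j + x) C suc j) * (j ! * x !)
    ≡⟨ regroup (suc j) ((suc j + x) C suc j) (j !) (x !) ⟩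
  ((suc j + x) C suc j) * (suc j ! * x !)
    ≡⟨ C-factorial (suc j) x ⟩
  (suc j + x) * (j + x) !
    ≡⟨ cong ((suc j + x) *_) (C-factorial j x) ⟨
  (suc j + x) * (((j + x) C j) * (j ! * x !))
    ≡⟨ *-assoc (suc j + x) ((j + x) C j) (j ! * x !) ⟨
  (suc j + x) * ((j + x) C j) * (j ! * x !) ∎)
  where
  open ≡-Reasoning
  instance _ = j !* x !≢0
  regroup : ∀ s c a b → s * c * (a * b) ≡ c * (s * a * b)
  regroup = solve-∀

-- Both sides are the multinomial coefficient (x + j + w)! / (x! j! w!), with the three blocks split
-- off in different orders.
C-trinomial : ∀ x j w →
  ((x + (j + w)) C x) * ((j + w) C j) ≡ ((x + j + w) C (x + j)) * ((j + x) C j)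
C-trinomial x j w = *-cancelʳ-≡ _ _ (x ! * (j ! * w !)) {{m*n≢0 _ _ {{x !≢0}} {{j !* w !≢0}}}} (begin
  ((x + (j + w)) C x) * ((j + w) C j) * (x ! * (j ! * w !))
    ≡⟨ regroup ((x + (j + w)) C x) ((j + w) C j) (x !) (j ! * w !) ⟩
  ((x + (j + w)) C x) * (x ! * (((j + w) C j) * (j ! * w !)))
    ≡⟨ cong (λ z → ((x + (j + w)) C x) * (x ! * z)) (C-factorial j w) ⟩
  ((x + (j + w)) C x) * (x ! * (j + w) !)
    ≡⟨ C-factorial x (j + w) ⟩
  (x + (j + w)) !
    ≡⟨ cong _! (+-assoc x j w) ⟨
  (x + j + w) !
    ≡⟨ C-factorial (x + j) w ⟨
  ((x + j + w) C (x + j)) * ((x + j) ! * w !)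
    ≡⟨ cong (λ z → ((x + j + w) C (x + j)) * (z ! * w !)) (+-comm x j) ⟩
  ((x + j + w) C (x + j)) * ((j + x) ! * w !)
    ≡⟨ cong (λ z → ((x + j + w) C (x + j)) * (z * w !)) (C-factorial j x) ⟨
  ((x + j + w) C (x + j)) * (((j + x) C j) * (j ! * x !) * w !)
    ≡⟨ regroup′ ((x + j + w) C (x + j)) ((j + x) C j) (j !) (x !) (w !) ⟩
  ((x + j + w) C (x + j)) * ((j + x) C j) * (x ! * (j ! * w !)) ∎)
  where
  open ≡-Reasoning
  regroup : ∀ a b c d → a * b * (c * d) ≡ a * (c * (b * d))
  regroup = solve-∀
  regroup′ : ∀ a b c d e → a * (b * (c * d) * e) ≡ a * b * (d * (c * e))
  regroup′ = solve-∀

-- The ratio (j + c + h) C j / (j + h) C j is the product of 1 + c/(h + i) over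
-- 1 ≤ i ≤ j, hence decreasing in h.
C-ratio-antitone : ∀ j c {h w} → h ≤ w →
  ((j + h) C j) * ((j + (c + w)) C j) ≤ ((j + (c + h)) C j) * ((j + w) C j)
C-ratio-antitone zero    c h≤w = ≤-refl
C-ratio-antitone (suc j) c {h} {w} h≤w = *-cancelˡ-≤ (suc j * suc j) (begin
  suc j * suc j * (((suc j + h) C suc j) * ((suc j + (c + w)) C suc j))
    ≡⟨ absorb h (c + w) ⟩
  (suc j + h) * (suc j + (c + w)) * (((j + h) C j) * ((j + (c + w)) C j))
    ≤⟨ *-mono-≤ linear (C-ratio-antitone j c h≤w) ⟩
  (suc j + (c + h)) * (suc j + w) * (((j + (c + h)) C j) * ((j + w) C j))
    ≡⟨ absorb (c + h) w ⟨
  suc j * suc j * (((suc j + (c + h)) C suc j) * ((suc j + w) C suc j)) ∎)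
  where
  open ≤-Reasoning
  interchange : ∀ a b c d → a * b * (c * d) ≡ a * c * (b * d)
  interchange = solve-∀

  absorb : ∀ x y → suc j * suc j * (((suc j + x) C suc j) * ((suc j + y) C suc j)) ≡
                   (suc j + x) * (suc j + y) * (((j + x) C j) * ((j + y) C j))
  absorb x y = trans (interchange (suc j) (suc j) ((suc j + x) C suc j) ((suc j + y) C suc j))
    (trans (cong₂ _*_ (C-absorption j x) (C-absorption j y)) (interchange (suc j + x) ((j + x) C j) (suc j + y) ((j + y) C j)))

  expandˡ : ∀ s c h w → (s + h) * (s + (c + w)) ≡ (s + h) * (s + w) + s * c + c * h
  expandˡ = solve-∀

  expandʳ : ∀ s c h w → (s + (c + h)) * (s + w) ≡ (s + h) * (s + w) + s * c + c * w
  expandʳ = solve-∀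

  -- The comparison of the factors for i = `suc j`: after expansion the sides differ only in `c * h`
  -- against `c * w`.
  linear : (suc j + h) * (suc j + (c + w)) ≤ (suc j + (c + h)) * (suc j + w)
  linear = begin
    (suc j + h) * (suc j + (c + w))                      ≡⟨ expandˡ (suc j) c h w ⟩
    (suc j + h) * (suc j + w) + suc j * c + c * h        ≤⟨ +-monoʳ-≤ _ (*-monoʳ-≤ c h≤w) ⟩
    (suc j + h) * (suc j + w) + suc j * c + c * w        ≡⟨ expandʳ (suc j) c h w ⟨
    (suc j + (c + h)) * (suc j + w)                      ∎

-- Here t = j + c: a set F of height h has a C j neighbours below it, and each of
-- these at most (j + h) C j above.  Equality holds at h = w, a = t + w.
C-shadow-ratio : ∀ j c {h w a} → h ≤ w → j + (c + h) ≤ a →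
  ((j + c + 2 * w) C (c + w)) * ((j + h) C j) ≤ ((j + c + 2 * w) C (j + c + w)) * (a C j)
-- The extra factor `(j + w) C j` allows `trinomial` to trade `p` for `q`, which puts the claim in
-- the form of `C-ratio-antitone`.
C-shadow-ratio j c {h} {w} {a} h≤w c+h≤a = *-cancelʳ-≤ _ _ ((j + w) C j) {{C≢0}} (begin
  p * ((j + h) C j) * ((j + w) C j)
    ≡⟨ swap p _ _ ⟩
  p * ((j + w) C j) * ((j + h) C j)
    ≡⟨ cong (_* ((j + h) C j)) trinomial ⟩
  q * ((j + (c + w)) C j) * ((j + h) C j)
    ≡⟨ rotate q _ _ ⟩
  q * (((j + h) C j) * ((j + (c + w)) C j))
    ≤⟨ *-monoʳ-≤ q (C-ratio-antitone j c h≤w) ⟩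
  q * (((j + (c + h)) C j) * ((j + w) C j))
    ≤⟨ *-monoʳ-≤ q (*-monoˡ-≤ ((j + w) C j) (C-monoˡ-≤ j c+h≤a)) ⟩
  q * ((a C j) * ((j + w) C j))
    ≡⟨ *-assoc q _ _ ⟨
  q * (a C j) * ((j + w) C j) ∎)
  where
  open ≤-Reasoning
  p = (j + c + 2 * w) C (c + w)
  q = (j + c + 2 * w) C (j + c + w)

  C≢0 : NonZero ((j + w) C j)
  C≢0 = m*n≢0⇒m≢0 _ {{subst NonZero (sym (C-factorial j w)) ((j + w) !≢0)}}

  swap : ∀ a b c → a * b * c ≡ a * c * b
  swap = solve-∀

  rotate : ∀ a b c → a * b * c ≡ a * (c * b)
  rotate = solve-∀

  size : ∀ j c w → c + w + (j + w) ≡ j + c + 2 * w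
  size = solve-∀

  size′ : ∀ j c w → c + w + j + w ≡ j + c + 2 * w
  size′ = solve-∀

  index : ∀ j c w → c + w + j ≡ j + c + w
  index = solve-∀

  -- Thus p/q is the ratio of `C-ratio-antitone` taken at h = w, its smallest value over h ≤ w.
  trinomial : p * ((j + w) C j) ≡ q * ((j + (c + w)) C j)
  trinomial = begin-equality
    p * ((j + w) C j)
      ≡⟨ cong (λ m → (m C (c + w)) * ((j + w) C j)) (size j c w) ⟨
    ((c + w + (j + w)) C (c + w)) * ((j + w) C j)
      ≡⟨ C-trinomial (c + w) j w ⟩
    ((c + w + j + w) C (c + w + j)) * ((j + (c + w)) C j)
      ≡⟨ cong₂ (λ m i → (m C i) * ((j + (c + w)) C j)) (size′ j c w) (index j c w) ⟩
    q * ((j + (c + w)) C j) ∎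

-- Subsets between two given sets

length-filter-map : {P : Pred Y ℓ₃} (P? : Decidable P) (f : X → Y) (xs : List X) →
  length (filter P? (map f xs)) ≡ length (filter (P? ∘ f) xs)
length-filter-map P? f []       = refl
length-filter-map P? f (x ∷ xs) with P? (f x)
... | yes _ = cong suc (length-filter-map P? f xs)
... | no  _ = length-filter-map P? f xs

length-filter-mono : {P : Pred X ℓ₂} {Q : Pred X ℓ₃} (P? : Decidable P) (Q? : Decidable Q) →
  P ⇒ Q → (xs : List X) → length (filter P? xs) ≤ length (filter Q? xs)
length-filter-mono P? Q? P⇒Q []       = z≤n
length-filter-mono P? Q? P⇒Q (x ∷ xs) with P? x | Q? x
... | yes px | no ¬qx = contradiction (P⇒Q px) ¬qx
... | yes _  | yes _  = s≤s (length-filter-mono P? Q? P⇒Q xs)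
... | no  _  | yes _  = m≤n⇒m≤1+n (length-filter-mono P? Q? P⇒Q xs)
... | no  _  | no  _  = length-filter-mono P? Q? P⇒Q xs

card-suc : {ℱ : Family (suc n)} (ℱ? : Decidable ℱ) →
  card ℱ? ≡ card (ℱ? ∘ (outside ∷_)) + card (ℱ? ∘ (inside ∷_))
card-suc {n} ℱ? = begin
  length (filter ℱ? (map (outside ∷_) (subsets n) ++ map (inside ∷_) (subsets n)))
    ≡⟨ cong length (filter-++ ℱ? (map (outside ∷_) (subsets n)) _) ⟩
  length (filter ℱ? (map (outside ∷_) (subsets n)) ++ filter ℱ? (map (inside ∷_) (subsets n)))
    ≡⟨ length-++ (filter ℱ? (map (outside ∷_) (subsets n))) ⟩
  length (filter ℱ? (map (outside ∷_) (subsets n))) + length (filter ℱ? (map (inside ∷_) (subsets n)))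
    ≡⟨ cong₂ _+_ (length-filter-map ℱ? _ (subsets n)) (length-filter-map ℱ? _ (subsets n)) ⟩
  card (ℱ? ∘ (outside ∷_)) + card (ℱ? ∘ (inside ∷_)) ∎
  where open ≡-Reasoning

card-cong : {ℱ 𝒢 : Family n} (ℱ? : Decidable ℱ) (𝒢? : Decidable 𝒢) → ℱ ≐ 𝒢 → card ℱ? ≡ card 𝒢?
card-cong ℱ? 𝒢? ℱ≐𝒢 = cong length (filter-≐ ℱ? 𝒢? ℱ≐𝒢 (subsets _))

card-mono : {ℱ 𝒢 : Family n} (ℱ? : Decidable ℱ) (𝒢? : Decidable 𝒢) → ℱ ⇒ 𝒢 → card ℱ? ≤ card 𝒢?
card-mono ℱ? 𝒢? ℱ⇒𝒢 = length-filter-mono ℱ? 𝒢? ℱ⇒𝒢 (subsets _)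

card-empty : {ℱ : Family n} (ℱ? : Decidable ℱ) → (∀ F → ¬ ℱ F) → card ℱ? ≡ 0
card-empty ℱ? ¬ℱ = cong length (filter-none ℱ? (universal ¬ℱ (subsets _)))

-- One rank of the interval from `A` to `B` in the subset lattice. It describes both sides of the
-- double count: the sets below `F` lie between its tail and `F`, and those above `G` between `G`
-- and `G` joined with the window.
Layer : Subset n → Subset n → ℕ → Family n
Layer A B r X = ∣ X ∣ ≡ ∣ A ∣ + r × A ⊆ X × X ⊆ B

layer? : (A B : Subset n) (r : ℕ) → Decidable (Layer A B r)
layer? A B r X = ∣ X ∣ ≟ ∣ A ∣ + r ×-dec A ⊆? X ×-dec X ⊆? B

-- Induction on the ground set. A point of `A` is forced into `X` and a point outside `B` is forced
-- out; a point of `B ─ A` leaves both choices, and these add up by Pascal's rule.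
card-layer : (A B : Subset n) (r : ℕ) → A ⊆ B → card (layer? A B r) ≡ ∣ B ─ A ∣ C r
card-layer [] [] zero    _ = refl
card-layer [] [] (suc r) _ = refl
card-layer (outside ∷ A) (outside ∷ B) r A⊆B = begin
  card L
    ≡⟨ card-suc L ⟩
  card (L ∘ (outside ∷_)) + card (L ∘ (inside ∷_))
    ≡⟨ cong₂ _+_
         (card-cong (L ∘ (outside ∷_)) (layer? A B r)
           ((λ (e , l , u) → e , drop-∷-⊆ l , drop-∷-⊆ u) , (λ (e , l , u) → e , s⊆s l , s⊆s u)))
         (card-empty (L ∘ (inside ∷_)) λ X (_ , _ , u) → contradiction (u here) λ ()) ⟩
  card (layer? A B r) + 0
    ≡⟨ +-identityʳ _ ⟩
  card (layer? A B r)
    ≡⟨ card-layer A B r (drop-∷-⊆ A⊆B) ⟩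
  ∣ B ─ A ∣ C r ∎
  where
  open ≡-Reasoning
  L = layer? (outside ∷ A) (outside ∷ B) r
card-layer (inside ∷ A) (outside ∷ B) r A⊆B = contradiction (A⊆B here) λ ()
card-layer (inside ∷ A) (inside ∷ B) r A⊆B = begin
  card L
    ≡⟨ card-suc L ⟩
  card (L ∘ (outside ∷_)) + card (L ∘ (inside ∷_))
    ≡⟨ cong₂ _+_
         (card-empty (L ∘ (outside ∷_)) λ X (_ , l , _) → contradiction (l here) λ ())
         (card-cong (L ∘ (inside ∷_)) (layer? A B r)
           ( (λ (e , l , u) → suc-injective e , drop-∷-⊆ l , drop-∷-⊆ u)
           , (λ (e , l , u) → cong suc e , s⊆s l , s⊆s u))) ⟩
  card (layer? A B r)
    ≡⟨ card-layer A B r (drop-∷-⊆ A⊆B) ⟩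
  ∣ B ─ A ∣ C r ∎
  where
  open ≡-Reasoning
  L = layer? (inside ∷ A) (inside ∷ B) r
card-layer (outside ∷ A) (inside ∷ B) zero A⊆B = begin
  card L
    ≡⟨ card-suc L ⟩
  card (L ∘ (outside ∷_)) + card (L ∘ (inside ∷_))
    ≡⟨ cong₂ _+_
         (card-cong (L ∘ (outside ∷_)) (layer? A B 0)
           ((λ (e , l , u) → e , drop-∷-⊆ l , drop-∷-⊆ u) , (λ (e , l , u) → e , s⊆s l , out⊆ u)))
         -- At rank 0 the new point cannot be used: `X` would have more elements than `A`.
         (card-empty (L ∘ (inside ∷_)) λ X (e , l , _) →
           <-irrefl (sym (trans e (+-identityʳ _))) (s≤s (p⊆q⇒∣p∣≤∣q∣ (drop-∷-⊆ l)))) ⟩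
  card (layer? A B 0) + 0
    ≡⟨ +-identityʳ _ ⟩
  card (layer? A B 0)
    ≡⟨ card-layer A B 0 (drop-∷-⊆ A⊆B) ⟩
  1 ∎
  where
  open ≡-Reasoning
  L = layer? (outside ∷ A) (inside ∷ B) 0
card-layer (outside ∷ A) (inside ∷ B) (suc r) A⊆B = begin
  card L
    ≡⟨ card-suc L ⟩
  card (L ∘ (outside ∷_)) + card (L ∘ (inside ∷_))
    ≡⟨ cong₂ _+_
         (card-cong (L ∘ (outside ∷_)) (layer? A B (suc r))
           ((λ (e , l , u) → e , drop-∷-⊆ l , drop-∷-⊆ u) , (λ (e , l , u) → e , s⊆s l , out⊆ u)))
         (card-cong (L ∘ (inside ∷_)) (layer? A B r)
           ( (λ (e , l , u) → suc-injective (trans e (+-suc _ r)) , drop-∷-⊆ l , drop-∷-⊆ u)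
           , (λ (e , l , u) → trans (cong suc e) (sym (+-suc _ r)) , out⊆ l , s⊆s u))) ⟩
  card (layer? A B (suc r)) + card (layer? A B r)
    ≡⟨ cong₂ _+_ (card-layer A B (suc r) (drop-∷-⊆ A⊆B)) (card-layer A B r (drop-∷-⊆ A⊆B)) ⟩
  ∣ B ─ A ∣ C suc r + ∣ B ─ A ∣ C r
    ≡⟨ +-comm (∣ B ─ A ∣ C suc r) _ ⟩
  ∣ B ─ A ∣ C r + ∣ B ─ A ∣ C suc r
    ≡⟨ nCk+nC[k+1]≡[n+1]C[k+1] ∣ B ─ A ∣ r ⟩
  suc ∣ B ─ A ∣ C suc r ∎
  where
  open ≡-Reasoning
  L = layer? (outside ∷ A) (inside ∷ B) (suc r)

-- Set difference and initial segments

∣p∩q∣+∣p─q∣≡∣p∣ : (p q : Subset n) → ∣ p ∩ q ∣ + ∣ p ─ q ∣ ≡ ∣ p ∣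
∣p∩q∣+∣p─q∣≡∣p∣ []            []            = refl
∣p∩q∣+∣p─q∣≡∣p∣ (outside ∷ p) (outside ∷ q) = ∣p∩q∣+∣p─q∣≡∣p∣ p q
∣p∩q∣+∣p─q∣≡∣p∣ (outside ∷ p) (inside  ∷ q) = ∣p∩q∣+∣p─q∣≡∣p∣ p q
∣p∩q∣+∣p─q∣≡∣p∣ (inside  ∷ p) (outside ∷ q) =
  trans (+-suc ∣ p ∩ q ∣ _) (cong suc (∣p∩q∣+∣p─q∣≡∣p∣ p q))
∣p∩q∣+∣p─q∣≡∣p∣ (inside  ∷ p) (inside  ∷ q) = cong suc (∣p∩q∣+∣p─q∣≡∣p∣ p q)

p─[p─q]≡p∩q : (p q : Subset n) → p ─ (p ─ q) ≡ p ∩ q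
p─[p─q]≡p∩q []            []            = refl
p─[p─q]≡p∩q (outside ∷ p) (outside ∷ q) = cong (outside ∷_) (p─[p─q]≡p∩q p q)
p─[p─q]≡p∩q (outside ∷ p) (inside  ∷ q) = cong (outside ∷_) (p─[p─q]≡p∩q p q)
p─[p─q]≡p∩q (inside  ∷ p) (outside ∷ q) = cong (outside ∷_) (p─[p─q]≡p∩q p q)
p─[p─q]≡p∩q (inside  ∷ p) (inside  ∷ q) = cong (inside ∷_) (p─[p─q]≡p∩q p q)

[p∪q]─p≡q─p : (p q : Subset n) → (p ∪ q) ─ p ≡ q ─ p
[p∪q]─p≡q─p []            []            = refl
[p∪q]─p≡q─p (outside ∷ p) (y ∷ q) = cong (y ∷_) ([p∪q]─p≡q─p p q)
[p∪q]─p≡q─p (inside  ∷ p) (y ∷ q) = cong (outside ∷_) ([p∪q]─p≡q─p p q)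

x∈p─q⇒x∉q : ∀ {x} (p q : Subset n) → x ∈ p ─ q → x ∉ q
x∈p─q⇒x∉q (_ ∷ p) (outside ∷ q) (there x∈) (there x∈q) = x∈p─q⇒x∉q p q x∈ x∈q
x∈p─q⇒x∉q (_ ∷ p) (inside  ∷ q) (there x∈) (there x∈q) = x∈p─q⇒x∉q p q x∈ x∈q

─-monoˡ-⊆ : {p q : Subset n} (r : Subset n) → p ⊆ q → p ─ r ⊆ q ─ r
─-monoˡ-⊆ {p = p} r p⊆q x∈ = x∈p∧x∉q⇒x∈p─q (p⊆q (p─q⊆p p r x∈)) (x∈p─q⇒x∉q p r x∈)

─-monoʳ-⊆ : (p : Subset n) {q r : Subset n} → q ⊆ r → p ─ r ⊆ p ─ q
─-monoʳ-⊆ p {r = r} q⊆r x∈ = x∈p∧x∉q⇒x∈p─q (p─q⊆p p r x∈) (λ x∈q → x∈p─q⇒x∉q p r x∈ (q⊆r x∈q))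

p─q⊆r⇒p⊆r∪q : {p q r : Subset n} → p ─ q ⊆ r → p ⊆ r ∪ q
p─q⊆r⇒p⊆r∪q {q = q} {r} p─q⊆r {x} x∈p with x ∈? q
... | yes x∈q = q⊆p∪q r q x∈q
... | no  x∉q = p⊆p∪q q (p─q⊆r (x∈p∧x∉q⇒x∈p─q x∈p x∉q))

-- Only an inequality, because the segment is cut off at `n`.
∣[1⋯m]∣≤m : ∀ m → ∣ [1⋯_] {n} m ∣ ≤ m
∣[1⋯m]∣≤m {zero}  m       = z≤n
∣[1⋯m]∣≤m {suc n} zero    = ∣[1⋯m]∣≤m {n} zero
∣[1⋯m]∣≤m {suc n} (suc m) = s≤s (∣[1⋯m]∣≤m {n} m)

[1⋯]-mono-⊆ : ∀ {m m′} → m ≤ m′ → [1⋯_] {n} m ⊆ [1⋯ m′ ]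
[1⋯]-mono-⊆ {zero}  {m}     {m′}     _   ()
[1⋯]-mono-⊆ {suc n} {zero}  {zero}   _   x∈         = x∈
[1⋯]-mono-⊆ {suc n} {zero}  {suc m′} _   (there x∈) = there ([1⋯]-mono-⊆ {n} {zero} {m′} z≤n x∈)
[1⋯]-mono-⊆ {suc n} {suc m} {suc m′} _   here       = here
[1⋯]-mono-⊆ {suc n} {suc m} {suc m′} m≤m′ (there x∈) = there ([1⋯]-mono-⊆ {n} {m} {m′} (s≤s⁻¹ m≤m′) x∈)

-- Heights and restricted shadows

module _ (t w : ℕ) (F : Subset n) where

  heavy⇒≤height : ∀ {h} → h ≤ w → Heavy t F h → h ≤ height t w F
  heavy⇒≤height h≤w hF =
    lookup (xs≤max 0 (filter (heavy? t F) (upTo (suc w))))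
      (∈-filter⁺ (heavy? t F) (∈-upTo⁺ (s≤s h≤w)) hF)

  private
    attained : ∃[ h ] (h ≤ w × Heavy t F h) → height t w F ≤ w × Heavy t F (height t w F)
    attained (h , h≤w , heavy) with argmax-sel id 0 (filter (heavy? t F) (upTo (suc w)))
    ... | inj₂ ∈candidates with i∈ , heavy′ ← ∈-filter⁻ (heavy? t F) {xs = upTo (suc w)} ∈candidates =
      s≤s⁻¹ (∈-upTo⁻ i∈) , heavy′
    -- Here `max` returned its default. The given heavy `h` is at most the height, so `h` is 0 and
    -- the default value is itself heavy.
    ... | inj₁ height≡0 =
      subst (_≤ w) (sym height≡0) z≤n ,
      subst (Heavy t F) (trans (n≤0⇒n≡0 (subst (h ≤_) height≡0 (heavy⇒≤height h≤w heavy))) (sym height≡0)) heavy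

  height≤width : ∃[ h ] (h ≤ w × Heavy t F h) → height t w F ≤ w
  height≤width bounded = proj₁ (attained bounded)

  heavy-height : ∃[ h ] (h ≤ w × Heavy t F h) → Heavy t F (height t w F)
  heavy-height bounded = proj₂ (attained bounded)

-- Two sets compared inside and outside a window

+-cancelʳ-compare : ∀ {a b c d} → a + b ≡ c + d → b ≤ d → c ≤ a
+-cancelʳ-compare {a} {b} {c} {d} eq b≤d = +-cancelʳ-≤ d c a (begin
  c + d ≡⟨ eq ⟨
  a + b ≤⟨ +-monoʳ-≤ a b≤d ⟩
  a + d ∎)
  where open ≤-Reasoning

module _ (F G : Subset n) {j : ℕ} (∣G∣+j≡∣F∣ : ∣ G ∣ + j ≡ ∣ F ∣) where

  private
    split : ∀ M → ∣ G ∩ M ∣ + j + ∣ G ─ M ∣ ≡ ∣ F ∩ M ∣ + ∣ F ─ M ∣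
    split M = begin
      ∣ G ∩ M ∣ + j + ∣ G ─ M ∣   ≡⟨ shuffle (∣ G ∩ M ∣) j (∣ G ─ M ∣) ⟩
      ∣ G ∩ M ∣ + ∣ G ─ M ∣ + j   ≡⟨ cong (_+ j) (∣p∩q∣+∣p─q∣≡∣p∣ G M) ⟩
      ∣ G ∣ + j                   ≡⟨ ∣G∣+j≡∣F∣ ⟩
      ∣ F ∣                       ≡⟨ ∣p∩q∣+∣p─q∣≡∣p∣ F M ⟨
      ∣ F ∩ M ∣ + ∣ F ─ M ∣       ∎
      where
      open ≡-Reasoning
      shuffle : ∀ a b c → a + b + c ≡ a + c + b
      shuffle = solve-∀

  -- `F` exceeds `G` by `j` in total and by at least 0 outside `M`, hence by at most `j` inside.
  G⊆F⇒∣F∩M∣≤∣G∩M∣+j : G ⊆ F → ∀ M → ∣ F ∩ M ∣ ≤ ∣ G ∩ M ∣ + j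
  G⊆F⇒∣F∩M∣≤∣G∩M∣+j G⊆F M = +-cancelʳ-compare (split M) (p⊆q⇒∣p∣≤∣q∣ (─-monoˡ-⊆ M G⊆F))

  -- Outside `M` the set `F` is no larger than `G`, so the whole surplus `j` must appear inside `M`.
  F─M⊆G⇒∣G∩M∣+j≤∣F∩M∣ : ∀ M → F ─ M ⊆ G → ∣ G ∩ M ∣ + j ≤ ∣ F ∩ M ∣
  F─M⊆G⇒∣G∩M∣+j≤∣F∩M∣ M F─M⊆G = +-cancelʳ-compare (sym (split M))
    (p⊆q⇒∣p∣≤∣q∣ (λ x∈ → x∈p∧x∉q⇒x∈p─q (F─M⊆G x∈) (x∈p─q⇒x∉q F M x∈)))

-- The bipartite graph between the family and its restricted shadow

module _ {k t w j : ℕ} {ℱ : Family n} (j≤k : j ≤ k) (uniform : Uniform k ℱ) (bound : WidthBound t ℱ w) where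

  -- Membership of `F` in `ℱ` is built into the relation, so that the degree of `G` counts only
  -- members of the family.
  Edge : Subset n → Family n
  Edge F G = ℱ F × shadowOf k t w j F G

  private
    window : Subset n → Subset n
    window F = [1⋯ t + 2 * height t w F ]

    ∣G∣+j≡∣F∣ : ∀ {F G} → Edge F G → ∣ G ∣ + j ≡ ∣ F ∣
    ∣G∣+j≡∣F∣ (F∈ℱ , ∣G∣≡ , _) = trans (cong (_+ j) ∣G∣≡) (trans (m∸n+n≡m j≤k) (sym (uniform F∈ℱ)))

  height-≤ : ∀ {F F′ G} → Edge F G → Edge F′ G → height t w F′ ≤ height t w F
  height-≤ {F} {F′} {G} e@(F∈ℱ , _ , G⊆F , T⊆G) e′@(F′∈ℱ , _ , G⊆F′ , _)
    with ≤-total (height t w F′) (height t w F)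
  ... | inj₁ h′≤h = h′≤h
  ... | inj₂ h≤h′ = heavy⇒≤height t w F (height≤width t w F′ (bound F′∈ℱ)) (begin
    t + height t w F′     ≤⟨ heavy-height t w F′ (bound F′∈ℱ) ⟩
    ∣ F′ ∩ window F′ ∣    ≤⟨ G⊆F⇒∣F∩M∣≤∣G∩M∣+j F′ G (∣G∣+j≡∣F∣ e′) G⊆F′ (window F′) ⟩
    -- The window of `F′` contains that of `F`, so what `F` has beyond it belongs to the tail of `F`
    -- and hence to `G`.
    ∣ G ∩ window F′ ∣ + j ≤⟨ F─M⊆G⇒∣G∩M∣+j≤∣F∩M∣ F G (∣G∣+j≡∣F∣ e) (window F′)
                              (λ x∈ → T⊆G (─-monoʳ-⊆ F ([1⋯]-mono-⊆ (+-monoʳ-≤ t (*-monoʳ-≤ 2 h≤h′))) x∈)) ⟩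
    ∣ F ∩ window F′ ∣     ∎)
    where open ≤-Reasoning

  height-unique : ∀ {F F′ G} → Edge F G → Edge F′ G → height t w F′ ≡ height t w F
  height-unique e e′ = ≤-antisym (height-≤ e e′) (height-≤ e′ e)

  ∣F∩[t+2h]∣ : Subset n → ℕ
  ∣F∩[t+2h]∣ F = ∣ F ∩ window F ∣

  module _ (ℱ? : Decidable ℱ) where

    edge? : ∀ F → Decidable (Edge F)
    edge? F G = ℱ? F ×-dec (∣ G ∣ ≟ k ∸ j ×-dec (G ⊆? F ×-dec tail t w F ⊆? G))

    -- Once the tail is fixed, the free elements are the `a` elements of `F` in its window. The
    -- layer count chooses the `a ∸ j` of them to keep; symmetry turns this into choosing the `j` to
    -- delete.
    card-below : ∀ {F} → ℱ F → j ≤ ∣F∩[t+2h]∣ F → card (edge? F) ≡ ∣F∩[t+2h]∣ F C j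
    card-below {F} F∈ℱ j≤a = begin
      card (edge? F)
        ≡⟨ card-cong (edge? F) (layer? T F r)
             ( (λ (_ , e , u , l) → trans e (sym size) , l , u)
             , (λ (e , l , u) → F∈ℱ , trans e size , u , l)) ⟩
      card (layer? T F r)
        ≡⟨ card-layer T F r (p─q⊆p F M) ⟩
      ∣ F ─ (F ─ M) ∣ C r
        ≡⟨ cong (λ S → ∣ S ∣ C r) (p─[p─q]≡p∩q F M) ⟩
      a C r
        ≡⟨ cong (_C r) (m∸n+n≡m j≤a) ⟨
      (r + j) C r
        ≡⟨ C-symmetric r j ⟩
      (r + j) C j
        ≡⟨ cong (_C j) (m∸n+n≡m j≤a) ⟩
      a C j ∎
      where
      open ≡-Reasoning
      M = window F
      T = tail t w F
      a = ∣F∩[t+2h]∣ F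
      r = a ∸ j

      size : ∣ T ∣ + r ≡ k ∸ j
      size = begin
        ∣ T ∣ + (a ∸ j) ≡⟨ +-∸-assoc (∣ T ∣) j≤a ⟨
        ∣ T ∣ + a ∸ j   ≡⟨ cong (_∸ j) (+-comm (∣ T ∣) a) ⟩
        a + ∣ T ∣ ∸ j   ≡⟨ cong (_∸ j) (∣p∩q∣+∣p─q∣≡∣p∣ F M) ⟩
        ∣ F ∣ ∸ j       ≡⟨ cong (_∸ j) (uniform F∈ℱ) ⟩
        k ∸ j           ∎

    -- By `height-unique` every `F′` above `G` has the window `M` of `F`, so it lies between `G` and
    -- `G ∪ M`, with `j` elements more than `G`.
    card-above : ∀ {F G} → Edge F G → card (λ F′ → edge? F′ G) ≤ (j + height t w F) C j
    card-above {F} {G} e@(F∈ℱ , ∣G∣≡ , G⊆F , T⊆G) = begin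
      card (λ F′ → edge? F′ G)
        ≤⟨ card-mono (λ F′ → edge? F′ G) (layer? G (G ∪ M) j) (λ {F′} → contained {F′}) ⟩
      card (layer? G (G ∪ M) j)
        ≡⟨ card-layer G (G ∪ M) j (p⊆p∪q M) ⟩
      ∣ (G ∪ M) ─ G ∣ C j
        ≡⟨ cong (λ S → ∣ S ∣ C j) ([p∪q]─p≡q─p G M) ⟩
      ∣ M ─ G ∣ C j
        ≤⟨ C-monoˡ-≤ j room ⟩
      (j + h) C j ∎
      where
      open ≤-Reasoning
      h = height t w F
      M = window F

      contained : ∀ {F′} → Edge F′ G → Layer G (G ∪ M) j F′
      contained {F′} e′@(_ , _ , G⊆F′ , T′⊆G) =
        sym (∣G∣+j≡∣F∣ e′) , G⊆F′ ,
        p─q⊆r⇒p⊆r∪q (subst (λ i → F′ ─ [1⋯ t + 2 * i ] ⊆ G) (height-unique e e′) T′⊆G)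

      regroup : ∀ t h j → t + 2 * h + j ≡ j + h + (t + h)
      regroup = solve-∀

      shuffle : ∀ a b c → a + (b + c) ≡ b + a + c
      shuffle = solve-∀

      -- `M` has at most t + 2h elements. Heaviness of `F` puts at least t + h of its elements
      -- there, and `G` lacks at most `j` of these.
      room : ∣ M ─ G ∣ ≤ j + h
      room = +-cancelʳ-≤ (t + h) _ _ (begin
        ∣ M ─ G ∣ + (t + h)           ≤⟨ +-monoʳ-≤ (∣ M ─ G ∣) (heavy-height t w F (bound F∈ℱ)) ⟩
        ∣ M ─ G ∣ + ∣ F ∩ M ∣         ≤⟨ +-monoʳ-≤ (∣ M ─ G ∣) (G⊆F⇒∣F∩M∣≤∣G∩M∣+j F G (∣G∣+j≡∣F∣ e) G⊆F M) ⟩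
        ∣ M ─ G ∣ + (∣ G ∩ M ∣ + j)   ≡⟨ shuffle (∣ M ─ G ∣) (∣ G ∩ M ∣) j ⟩
        ∣ G ∩ M ∣ + ∣ M ─ G ∣ + j     ≡⟨ cong (λ S → ∣ S ∣ + ∣ M ─ G ∣ + j) (∩-comm G M) ⟩
        ∣ M ∩ G ∣ + ∣ M ─ G ∣ + j     ≡⟨ cong (_+ j) (∣p∩q∣+∣p─q∣≡∣p∣ M G) ⟩
        ∣ M ∣ + j                     ≤⟨ +-monoˡ-≤ j (∣[1⋯m]∣≤m {n} (t + 2 * h)) ⟩
        t + 2 * h + j                 ≡⟨ regroup t h j ⟩
        j + h + (t + h)               ∎)

    shadow-bound : j ≤ t →
      ((t + 2 * w) C (t ∸ j + w)) * card ℱ? ≤ ((t + 2 * w) C (t + w)) * card (shadow? k t w j ℱ?)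
    shadow-bound j≤t = weighted-double-count edge? (subsets n) (subsets n) ℱ? (shadow? k t w j ℱ?) p q
      -- Every member of the family has a neighbour: `a C j` is positive because j ≤ t ≤ a.
      (λ F∈ℱ → subst (0 <_) (sym (card-below F∈ℱ (j≤a F∈ℱ))) (>-nonZero⁻¹ _ {{C-nonZero (j≤a F∈ℱ)}}))
      (λ {F} e → F , e)
      λ {F} {G} e@(F∈ℱ , _) → begin
        p * card (λ F′ → edge? F′ G)     ≤⟨ *-monoʳ-≤ p (card-above e) ⟩
        p * ((j + height t w F) C j)     ≤⟨ ratio (height≤width t w F (bound F∈ℱ)) (heavy-height t w F (bound F∈ℱ)) ⟩
        q * (∣F∩[t+2h]∣ F C j)           ≡⟨ cong (q *_) (card-below F∈ℱ (j≤a F∈ℱ)) ⟨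
        q * card (edge? F)               ∎
      where
      open ≤-Reasoning
      p = (t + 2 * w) C (t ∸ j + w)
      q = (t + 2 * w) C (t + w)

      j≤a : ∀ {F} → ℱ F → j ≤ ∣F∩[t+2h]∣ F
      j≤a {F} F∈ℱ = ≤-trans j≤t (≤-trans (m≤m+n t _) (heavy-height t w F (bound F∈ℱ)))

      -- `C-shadow-ratio` with c = `t ∸ j`, transported along j + (t ∸ j) = t.
      ratio : ∀ {h a} → h ≤ w → t + h ≤ a → p * ((j + h) C j) ≤ q * (a C j)
      ratio {h} {a} h≤w t+h≤a = subst
        (λ s → ((s + 2 * w) C (t ∸ j + w)) * ((j + h) C j) ≤ ((s + 2 * w) C (s + w)) * (a C j))
        (m+[n∸m]≡n j≤t)
        (C-shadow-ratio j (t ∸ j) h≤w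
          (≤-trans (≤-reflexive (trans (sym (+-assoc j (t ∸ j) h)) (cong (_+ h) (m+[n∸m]≡n j≤t)))) t+h≤a))

-- From natural numbers to the rational inequality

ratio-≥ : ∀ a b p q .{{_ : NonZero q}} → p * a ≤ q * b → (+ b / 1) ≥ℚ (+ a / 1) *ℚ (+ p / q)
-- The unnormalised order is cross-multiplication, so only factors 1 and the order of products
-- remain to be adjusted. Matching the denominator as a successor lets the fractions reduce.
ratio-≥ a b p (suc q) pa≤qb = *≤* (subst₂ ℤ._≤_ lhs rhs (+≤+ pa≤qb))
  where
  lhs : + (p * a) ≡ + a ℤ.* + p ℤ.* + 1
  lhs = trans (cong +_ (*-comm p a)) (trans (ℤ.pos-* a p) (sym (ℤ.*-identityʳ _)))
  rhs : + (suc q * b) ≡ + b ℤ.* + (1 * suc q)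
  rhs = trans (cong +_ (trans (*-comm (suc q) b) (cong (b *_) (sym (*-identityˡ (suc q)))))) (ℤ.pos-* b (1 * suc q))

theorem2p10 : (n k t : ℕ) → k < n → t < k → 1 ≤ t →
  (ℱ : Family n) (ℱ? : Decidable ℱ) →
  Uniform k ℱ → Shifted k ℱ → PseudoIntersecting k t ℱ →
  (w : ℕ) → IsWidth t ℱ w →
  (j : ℕ) → 0 < j → j ≤ t →
  (+ card (shadow? k t w j ℱ?) / 1)
    ≥ℚ (+ card ℱ? / 1) *ℚ
       _/_ (+ ((t + 2 * w) C (t ∸ j + w))) ((t + 2 * w) C (t + w)) {{denominator-nonZero t w}}
theorem2p10 n k t _ t<k _ ℱ ℱ? uniform _ _ w (bound , _) j _ j≤t =
  ratio-≥ (card ℱ?) (card (shadow? k t w j ℱ?)) _ _ {{denominator-nonZero t w}}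
    (shadow-bound (≤-trans j≤t (<⇒≤ t<k)) uniform bound ℱ? j≤t)
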